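{- If $p$ is a non-zero integer and $n$ is a positive integer, then $$\sum_{k=0}^n\Bigl(\frac{16}{5}\Bigr)^k\frac{n}{n+k}\binom{n+k}{n-k}F_{2p}^{2(n-k)}=\frac{25^nF_p^{4n}+L_p^{4n}}{2\cdot5^n},$$ $$\sum_{k=0}^n(-1)^{n-k}\Bigl(\frac45\Bigr)^k\frac{n}{n+k}\binom{n+k}{n-k}\Bigl(\frac{F_{2p}}{L_{2p}}\Bigr)^{2(n-k)}=\frac{25^nF_p^{4n}+L_p^{4n}}{2\cdot5^nL_{2p}^{2n}}.$$ In particular, $$\sum_{k=0}^n\Bigl(\frac{16}{5}\Bigr)^k\frac{n}{n+k}\binom{n+k}{n-k}=\frac{25^n+1}{2\cdot5^n},\qquad \sum_{k=0}^n(-1)^{n-k}\Bigl(\frac{36}{5}\Bigr)^k\frac{n}{n+k}\binom{n+k}{n-k}=\frac{25^n+1}{2\cdot5^n}.$$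
   Context: $F_n$ and $L_n$ ($n\in\mathbb{Z}$) are the Fibonacci and Lucas numbers: $F_0=0$, $F_1=1$, $F_n=F_{n-1}+F_{n-2}$; $L_0=2$, $L_1=1$, $L_n=L_{n-1}+L_{n-2}$, extended to negative indices by $F_{ -n}=(-1)^{n-1}F_n$, $L_{ -n}=(-1)^nL_n$. -}

module Defs where

import Algebra.Definitions.RawSemiring as RawSemiringDefinitions
open import Data.Fin.Base using (toℕ)
open import Data.Integer.Base as ℤ using (ℤ; +_; -[1+_]; -1ℤ)
import Data.Integer.Properties as ℤ
open import Data.Nat.Base as ℕ using (ℕ; zero; suc)
import Data.Nat.Properties as ℕ
open import Data.Rational.Base as ℚ using (ℚ; 0ℚ; 1ℚ; _*_; 1/_)
open import Data.Rational.Literals using (fromℤ)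
import Data.Rational.Properties as ℚ
open import Relation.Binary.PropositionalEquality
  using (_≡_; _≢_; refl; cong; module ≡-Reasoning)

fib : ℕ → ℕ
fib 0             = 0
fib 1             = 1
fib (suc (suc n)) = fib (suc n) ℕ.+ fib n

luc : ℕ → ℕ
luc 0             = 2
luc 1             = 1
luc (suc (suc n)) = luc (suc n) ℕ.+ luc n

-- Since -[1+ m ] is -(m + 1), these are F₋ₙ = (-1)ⁿ⁻¹ Fₙ and L₋ₙ = (-1)ⁿ Lₙ
-- with n = m + 1.

F : ℤ → ℤ
F (+ n)    = + fib n
F -[1+ m ] = -1ℤ ℤ.^ m ℤ.* + fib (suc m)

L : ℤ → ℤ
L (+ n)    = + luc n
L -[1+ m ] = -1ℤ ℤ.^ suc m ℤ.* + luc (suc m)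

open RawSemiringDefinitions ℚ.+-*-rawSemiring public using (_^_; sum)

-- The upper bound is included: k ranges over 0, …, n.
∑≤ : ℕ → (ℕ → ℚ) → ℚ
∑≤ n f = sum {suc n} (λ i → f (toℕ i))

infix 5 ∑≤
syntax ∑≤ n (λ k → e) = ∑[ k ≤ n ] e

luc-nonZero : ∀ n → ℕ.NonZero (luc n)
luc-nonZero 0             = _
luc-nonZero 1             = _
luc-nonZero (suc (suc n)) = ℕ.>-nonZero
  (ℕ.<-≤-trans (ℕ.>-nonZero⁻¹ (luc (suc n)) {{luc-nonZero (suc n)}})
               (ℕ.m≤m+n (luc (suc n)) (luc n)))

±1-nonZero : ∀ n → ℤ.NonZero (-1ℤ ℤ.^ n)
±1-nonZero zero    = _
±1-nonZero (suc n) = ℤ.i*j≢0 -1ℤ (-1ℤ ℤ.^ n) {{_}} {{±1-nonZero n}}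

L-nonZero : ∀ i → ℤ.NonZero (L i)
L-nonZero (+ n)    = luc-nonZero n
L-nonZero -[1+ m ] = ℤ.i*j≢0 (-1ℤ ℤ.^ suc m) (+ luc (suc m))
  {{±1-nonZero (suc m)}} {{luc-nonZero (suc m)}}

nonZero⇒≢0 : ∀ {x} → ℚ.NonZero x → x ≢ 0ℚ
nonZero⇒≢0 () refl

*-nonZero : ∀ x y → ℚ.NonZero x → ℚ.NonZero y → ℚ.NonZero (x * y)
*-nonZero x y x≢0 y≢0 = ℚ.≢-nonZero λ xy≡0 → nonZero⇒≢0 y≢0 (begin
  y                ≡⟨ ℚ.*-identityˡ y ⟨
  1ℚ * y           ≡⟨ cong (_* y) (ℚ.*-inverseˡ x) ⟨
  1/ x * x * y     ≡⟨ ℚ.*-assoc (1/ x) x y ⟩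
  1/ x * (x * y)   ≡⟨ cong (1/ x *_) xy≡0 ⟩
  1/ x * 0ℚ        ≡⟨ ℚ.*-zeroʳ (1/ x) ⟩
  0ℚ               ∎)
  where
  open ≡-Reasoning
  instance _ = x≢0

^-nonZero : ∀ x n → ℚ.NonZero x → ℚ.NonZero (x ^ n)
^-nonZero x zero    _   = _
^-nonZero x (suc n) x≢0 = *-nonZero x (x ^ n) x≢0 (^-nonZero x n x≢0)

fromℤ-L-nonZero : ∀ i → ℚ.NonZero (fromℤ (L i))
fromℤ-L-nonZero i = L-nonZero i

2*5^n-nonZero : ∀ n → ℚ.NonZero (fromℤ (+ 2) * fromℤ (+ 5) ^ n)
2*5^n-nonZero n =
  *-nonZero (fromℤ (+ 2)) (fromℤ (+ 5) ^ n) _ (^-nonZero (fromℤ (+ 5)) n _)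

2*5^n*L^m-nonZero : ∀ n i m →
  ℚ.NonZero (fromℤ (+ 2) * fromℤ (+ 5) ^ n * fromℤ (L i) ^ m)
2*5^n*L^m-nonZero n i m =
  *-nonZero (fromℤ (+ 2) * fromℤ (+ 5) ^ n) (fromℤ (L i) ^ m) (2*5^n-nonZero n)
    (^-nonZero (fromℤ (L i)) m (fromℤ-L-nonZero i))

m+n-nonZero : ∀ m n .{{_ : ℕ.NonZero m}} → ℕ.NonZero (m ℕ.+ n)
m+n-nonZero (suc m) n = _

{-# OPTIONS --safe #-}

-- Put d = n − k.  Twice the weight n/(n+k) · C(n+k, d) is C(n+k, d) + C(n+k−1, d−1),
-- so twice Σ n/(n+k) C(n+k, d) xᵏ yᵈ is U n + y U (n−1) with U n = Σ C(2k+d, d) xᵏ yᵈ.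
-- By Pascal's rule this is a sequence V with V 0 = 2, V 1 = x + 2y and
-- V (n+2) = (x + 2y) V (n+1) − y² V n.  Hence Dⁿ V n = aⁿ + bⁿ as soon as
-- D (x + 2y) = a + b and (D y)² = a b.  For the first two sums take a = 25 Fₚ⁴ and
-- b = Lₚ⁴, with D = 5 resp. D = 5 L₂ₚ²; the conditions then follow from F₂ₚ = Fₚ Lₚ,
-- (Lₚ² − 5 Fₚ²)² = 16 and L₂ₚ² = 5 F₂ₚ² + 4.  For the last two take D = 5, a = 25, b = 1.
module Submission where
open import Defs
open import Algebra.Bundles using (CommutativeRing)
open import Data.Integer.Base as ℤ using (ℤ; +_; -[1+_]; -1ℤ)
import Data.Integer.Properties as ℤ
import Data.Integer.Tactic.RingSolver as ℤ-Solver
open import Data.Nat.Base as ℕ using (ℕ; zero; suc; _∸_)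
open import Data.Nat.Combinatorics
  using (_C_; nCn≡1; nCk+nC[k+1]≡[n+1]C[k+1]; nC1≡n)
import Data.Nat.Properties as ℕ
import Data.Nat.Tactic.RingSolver as ℕ-Solver
open import Data.Product.Base using (_×_; _,_)
open import Data.Rational.Base as ℚ
  using (ℚ; 0ℚ; 1ℚ; _+_; _*_; -_; _-_; _/_; _÷_; 1/_)
open import Data.Rational.Literals using (fromℤ)
import Data.Rational.Properties as ℚ
open import Data.Rational.Unnormalised.Base as ℚᵘ using (mkℚᵘ; *≡*)
import Data.Rational.Unnormalised.Properties as ℚᵘ
open import Level using (0ℓ)
open import Relation.Binary.PropositionalEquality
  using (_≡_; refl; sym; trans; cong; cong₂; module ≡-Reasoning)
open import Relation.Nullary.Decidable using (dec⇒maybe)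
open import Tactic.RingSolver using (solve-∀)
import Tactic.RingSolver.Core.AlmostCommutativeRing as ACR

open import Algebra.Properties.CommutativeSemiring.Exp
  (CommutativeRing.commutativeSemiring ℚ.+-*-commutativeRing)
  using (^-assocʳ; ^-distrib-*)

open ≡-Reasoning

-- Integers and quotients inside the rationals.

ℚ-ring : ACR.AlmostCommutativeRing 0ℓ 0ℓ
ℚ-ring = ACR.fromCommutativeRing ℚ.+-*-commutativeRing λ x → dec⇒maybe (0ℚ ℚ.≟ x)

fromℤ-+ : ∀ i j → fromℤ (i ℤ.+ j) ≡ fromℤ i + fromℤ j
fromℤ-+ i j = ℚ.toℚᵘ-injective (ℚᵘ.≃-trans (*≡* (lemma i j))
  (ℚᵘ.≃-sym (ℚ.toℚᵘ-homo-+ (fromℤ i) (fromℤ j))))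
  where
  lemma : ∀ i j → (i ℤ.+ j) ℤ.* + 1 ≡ (i ℤ.* + 1 ℤ.+ j ℤ.* + 1) ℤ.* + 1
  lemma = ℤ-Solver.solve-∀

fromℤ-* : ∀ i j → fromℤ (i ℤ.* j) ≡ fromℤ i * fromℤ j
fromℤ-* i j = ℚ.toℚᵘ-injective (ℚᵘ.≃-sym (ℚ.toℚᵘ-homo-* (fromℤ i) (fromℤ j)))

-- `i / n` is reduced by a gcd and does not compute for variable `i` and `n`. The unnormalised
-- fraction `mkℚᵘ i m` is equivalent to it, and for that one the claim is a ring identity.
/-*-cancel : ∀ i n .{{_ : ℕ.NonZero n}} → (i / n) * fromℤ (+ n) ≡ fromℤ i
/-*-cancel i n@(suc m) = ℚ.toℚᵘ-injective (ℚᵘ.≃-trans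
  (ℚ.toℚᵘ-homo-* (i / n) (fromℤ (+ n))) (ℚᵘ.≃-trans
  (ℚᵘ.*-congʳ {x = mkℚᵘ (+ n) 0} (ℚ.toℚᵘ-fromℚᵘ (mkℚᵘ i m)))
  (*≡* (lemma i (+ n)))))
  where
  lemma : ∀ i n → i ℤ.* n ℤ.* + 1 ≡ i ℤ.* (n ℤ.* + 1)
  lemma = ℤ-Solver.solve-∀

÷-*-cancel : ∀ p q .{{_ : ℚ.NonZero q}} → (p ÷ q) * q ≡ p
÷-*-cancel p q = begin
  p * 1/ q * q    ≡⟨ ℚ.*-assoc p (1/ q) q ⟩
  p * (1/ q * q)  ≡⟨ cong (p *_) (ℚ.*-inverseˡ q) ⟩
  p * 1ℚ          ≡⟨ ℚ.*-identityʳ p ⟩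
  p               ∎

*⇒÷ : ∀ p q r .{{_ : ℚ.NonZero q}} → q * p ≡ r → p ≡ r ÷ q
*⇒÷ p q r qp≡r = begin
  p               ≡⟨ ℚ.*-identityʳ p ⟨
  p * 1ℚ          ≡⟨ cong (p *_) (ℚ.*-inverseʳ q) ⟨
  p * (q * 1/ q)  ≡⟨ ℚ.*-assoc p q (1/ q) ⟨
  p * q * 1/ q    ≡⟨ cong (_* 1/ q) (ℚ.*-comm p q) ⟩
  q * p * 1/ q    ≡⟨ cong (_* 1/ q) qp≡r ⟩
  r ÷ q           ∎

-- Sums over antidiagonals.

-- The sum of f k d over k + d = n; it avoids the truncated n ∸ k.
diag : ℕ → (ℕ → ℕ → ℚ) → ℚ
diag zero    f = f 0 0
diag (suc n) f = f 0 (suc n) + diag n (λ k d → f (suc k) d)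

∑≤≡diag : ∀ n f → ∑≤ n (λ k → f k (n ∸ k)) ≡ diag n f
∑≤≡diag zero    f = ℚ.+-identityʳ (f 0 0)
∑≤≡diag (suc n) f = cong (_+_ (f 0 (suc n))) (∑≤≡diag n (λ k d → f (suc k) d))

diag-cong : ∀ n {f g} → (∀ k d → k ℕ.+ d ≡ n → f k d ≡ g k d) → diag n f ≡ diag n g
diag-cong zero    f≡g = f≡g 0 0 refl
diag-cong (suc n) f≡g = cong₂ _+_ (f≡g 0 (suc n) refl)
  (diag-cong n λ k d k+d≡n → f≡g (suc k) d (cong suc k+d≡n))

diag-+ : ∀ n f g → diag n (λ k d → f k d + g k d) ≡ diag n f + diag n g
diag-+ zero    f g = refl
diag-+ (suc n) f g = trans
  (cong (_+_ (f 0 (suc n) + g 0 (suc n))) (diag-+ n (λ k d → f (suc k) d) (λ k d → g (suc k) d)))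
  (lemma (f 0 (suc n)) (g 0 (suc n)) _ _)
  where
  lemma : ∀ p q r s → (p + q) + (r + s) ≡ (p + r) + (q + s)
  lemma = solve-∀ ℚ-ring

*-distribˡ-diag : ∀ n x f → x * diag n f ≡ diag n (λ k d → x * f k d)
*-distribˡ-diag zero    x f = refl
*-distribˡ-diag (suc n) x f = trans (ℚ.*-distribˡ-+ x (f 0 (suc n)) _)
  (cong (_+_ (x * f 0 (suc n))) (*-distribˡ-diag n x (λ k d → f (suc k) d)))

-- The definition peels off the end k = 0; this peels off the opposite end d = 0, so that every
-- remaining entry has the form `suc d`, as Pascal's rule requires.
diag-last : ∀ n f → diag (suc n) f ≡ diag n (λ k d → f k (suc d)) + f (suc n) 0
diag-last zero    f = refl
diag-last (suc n) f = trans
  (cong (_+_ (f 0 (suc (suc n)))) (diag-last n (λ k d → f (suc k) d)))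
  (sym (ℚ.+-assoc (f 0 (suc (suc n))) _ _))

-- An interior entry of `f` splits into contributions of its two neighbours, as in Pascal's
-- triangle. Each end entry has a single neighbour and supplies exactly the term by which the
-- interior contributions fall short of `diag n g` or `diag n h`.
diag-pascal : ∀ n f g h →
  (∀ d → f 0 (suc d) ≡ h 0 d) →
  (∀ k → f (suc k) 0 ≡ g k 0) →
  (∀ k d → f (suc k) (suc d) ≡ g k (suc d) + h (suc k) d) →
  diag (suc n) f ≡ diag n g + diag n h
diag-pascal zero    f g h left top inner =
  trans (cong₂ _+_ (left 0) (top 0)) (ℚ.+-comm (h 0 0) (g 0 0))
diag-pascal (suc n) f g h left top inner = begin
  f 0 (suc (suc n)) + diag (suc n) (λ k d → f (suc k) d)
    ≡⟨ cong (_+_ (f 0 (suc (suc n)))) (diag-last n (λ k d → f (suc k) d)) ⟩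
  f 0 (suc (suc n)) + (diag n (λ k d → f (suc k) (suc d)) + f (suc (suc n)) 0)
    ≡⟨ cong₂ _+_ (left (suc n)) (cong₂ _+_
        (trans (diag-cong n λ k d _ → inner k d)
          (diag-+ n (λ k d → g k (suc d)) (λ k d → h (suc k) d)))
        (top (suc n))) ⟩
  h 0 (suc n) + ((G + H) + g (suc n) 0)
    ≡⟨ lemma (h 0 (suc n)) G H (g (suc n) 0) ⟩
  (G + g (suc n) 0) + (h 0 (suc n) + H)
    ≡⟨ cong (_+ diag (suc n) h) (diag-last n g) ⟨
  diag (suc n) g + diag (suc n) h  ∎
  where
  G = diag n (λ k d → g k (suc d))
  H = diag n (λ k d → h (suc k) d)
  lemma : ∀ p q r s → p + ((q + r) + s) ≡ (q + s) + (p + r)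
  lemma = solve-∀ ℚ-ring

-- Binomial coefficients.

pascal : ∀ n k → fromℤ (+ (suc n C suc k)) ≡ fromℤ (+ (n C k)) + fromℤ (+ (n C suc k))
pascal n k = trans (cong (λ i → fromℤ (+ i)) (sym (nCk+nC[k+1]≡[n+1]C[k+1] n k)))
  (fromℤ-+ (+ (n C k)) (+ (n C suc k)))

-- The absorption identity, which later removes the denominator n + k of the weight. Pascal's rule
-- on the left yields one extra copy of `P` and two instances of the induction hypothesis; Pascal's
-- rule one row higher recombines these.
[k+1]*[n+1]C[k+1]≡[n+1]*nCk : ∀ n k → suc k ℕ.* (suc n C suc k) ≡ suc n ℕ.* (n C k)
[k+1]*[n+1]C[k+1]≡[n+1]*nCk n zero = trans (ℕ.*-identityˡ (suc n C 1))
  (trans (nC1≡n (suc n)) (sym (ℕ.*-identityʳ (suc n))))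
[k+1]*[n+1]C[k+1]≡[n+1]*nCk zero (suc k) = ℕ.*-zeroʳ (suc (suc k))
[k+1]*[n+1]C[k+1]≡[n+1]*nCk (suc n) (suc k) = begin
  (2 ℕ.+ k) ℕ.* (suc (suc n) C suc (suc k))
    ≡⟨ cong ((2 ℕ.+ k) ℕ.*_) (nCk+nC[k+1]≡[n+1]C[k+1] (suc n) (suc k)) ⟨
  (2 ℕ.+ k) ℕ.* (P ℕ.+ (suc n C suc (suc k)))
    ≡⟨ lemma₁ k P (suc n C suc (suc k)) ⟩
  P ℕ.+ (suc k ℕ.* P ℕ.+ (2 ℕ.+ k) ℕ.* (suc n C suc (suc k)))
    ≡⟨ cong (P ℕ.+_) (cong₂ ℕ._+_ ([k+1]*[n+1]C[k+1]≡[n+1]*nCk n k)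
                                  ([k+1]*[n+1]C[k+1]≡[n+1]*nCk n (suc k))) ⟩
  P ℕ.+ (suc n ℕ.* (n C k) ℕ.+ suc n ℕ.* (n C suc k))
    ≡⟨ cong (P ℕ.+_) (ℕ.*-distribˡ-+ (suc n) (n C k) (n C suc k)) ⟨
  P ℕ.+ suc n ℕ.* ((n C k) ℕ.+ (n C suc k))
    ≡⟨ cong (λ i → P ℕ.+ suc n ℕ.* i) (nCk+nC[k+1]≡[n+1]C[k+1] n k) ⟩
  suc (suc n) ℕ.* P ∎
  where
  P = suc n C suc k
  lemma₁ : ∀ k p q → (2 ℕ.+ k) ℕ.* (p ℕ.+ q) ≡ p ℕ.+ (suc k ℕ.* p ℕ.+ (2 ℕ.+ k) ℕ.* q)
  lemma₁ = ℕ-Solver.solve-∀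

-- The binomial sums as a second-order linear recurrence.

module _ (x y : ℚ) where

  -- The parity is that of upper minus lower index, 2k or 2k + 1. For y = 1 the sums over k + d = n
  -- are the two families of Morgan-Voyce polynomials in x. Writing `k ℕ.* 2` lets `suc k ℕ.* 2`
  -- unfold to two successors, ready for Pascal's rule.
  evenTerm oddTerm : ℕ → ℕ → ℚ
  evenTerm k d = fromℤ (+ ((k ℕ.* 2 ℕ.+ d) C d)) * (x ^ k * y ^ d)
  oddTerm  k d = fromℤ (+ (suc (k ℕ.* 2 ℕ.+ d) C d)) * (x ^ k * y ^ d)

  even odd : ℕ → ℚ
  even n = diag n evenTerm
  odd  n = diag n oddTerm

  -- By Pascal's rule, C(2k+d, d) = C(2k-1+d, d) + C(2k+d-1, d-1). The first summand is an odd
  -- coefficient at k - 1, which costs a factor x; the second is an even one at d - 1, which costs a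
  -- factor y.
  even-suc : ∀ n → even (suc n) ≡ x * odd n + y * even n
  even-suc n = trans
    (diag-pascal n evenTerm (λ k d → x * oddTerm k d) (λ k d → y * evenTerm k d)
      left top inner)
    (sym (cong₂ _+_ (*-distribˡ-diag n x oddTerm) (*-distribˡ-diag n y evenTerm)))
    where
    left : ∀ d → evenTerm 0 (suc d) ≡ y * evenTerm 0 d
    left d = begin
      fromℤ (+ (suc d C suc d)) * (1ℚ * (y * y ^ d))
        ≡⟨ cong (λ i → fromℤ (+ i) * (1ℚ * (y * y ^ d))) (trans (nCn≡1 (suc d)) (sym (nCn≡1 d))) ⟩
      fromℤ (+ (d C d)) * (1ℚ * (y * y ^ d))
        ≡⟨ lemma (fromℤ (+ (d C d))) y (y ^ d) ⟩
      y * (fromℤ (+ (d C d)) * (1ℚ * y ^ d)) ∎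
      where
      lemma : ∀ c y z → c * (1ℚ * (y * z)) ≡ y * (c * (1ℚ * z))
      lemma = solve-∀ ℚ-ring
    top : ∀ k → evenTerm (suc k) 0 ≡ x * oddTerm k 0
    top k = lemma x (x ^ k)
      where
      lemma : ∀ x z → 1ℚ * (x * z * 1ℚ) ≡ x * (1ℚ * (z * 1ℚ))
      lemma = solve-∀ ℚ-ring
    inner : ∀ k d → evenTerm (suc k) (suc d) ≡ x * oddTerm k (suc d) + y * evenTerm (suc k) d
    inner k d = begin
      fromℤ (+ (suc N C suc d)) * (x * x ^ k * (y * y ^ d))
        ≡⟨ cong (_* (x * x ^ k * (y * y ^ d))) (pascal N d) ⟩
      (fromℤ (+ (N C d)) + fromℤ (+ (N C suc d))) * (x * x ^ k * (y * y ^ d))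
        ≡⟨ lemma (fromℤ (+ (N C d))) (fromℤ (+ (N C suc d))) x (x ^ k) y (y ^ d) ⟩
      x * oddTerm k (suc d) + y * (fromℤ (+ (N C d)) * (x * x ^ k * y ^ d))
        ≡⟨ cong (λ i → x * oddTerm k (suc d) + y * (fromℤ (+ (suc i C d)) * (x * x ^ k * y ^ d)))
             (ℕ.+-suc (k ℕ.* 2) d) ⟩
      x * oddTerm k (suc d) + y * evenTerm (suc k) d ∎
      where
      N = suc (k ℕ.* 2 ℕ.+ suc d)
      lemma : ∀ p q x z y t →
        (p + q) * (x * z * (y * t)) ≡ x * (q * (z * (y * t))) + y * (p * (x * z * t))
      lemma = solve-∀ ℚ-ring

  -- Here Pascal's rule gives C(2k+1+d, d) = C(2k+d, d) + C(2k+d, d-1), with the same k in both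
  -- summands, so only entries with d > 0 are split.
  odd-suc : ∀ n → odd (suc n) ≡ even (suc n) + y * odd n
  odd-suc n = begin
    odd (suc n)
      ≡⟨ diag-last n oddTerm ⟩
    -- The last entry may be read as even or odd: both binomial coefficients over 0 are 1.
    diag n (λ k d → oddTerm k (suc d)) + evenTerm (suc n) 0
      ≡⟨ cong (_+ evenTerm (suc n) 0)
           (trans (diag-cong n λ k d _ → inner k d)
             (diag-+ n (λ k d → evenTerm k (suc d)) (λ k d → y * oddTerm k d))) ⟩
    diag n (λ k d → evenTerm k (suc d)) + diag n (λ k d → y * oddTerm k d) + evenTerm (suc n) 0
      ≡⟨ lemma (diag n (λ k d → evenTerm k (suc d))) (diag n (λ k d → y * oddTerm k d)) (evenTerm (suc n) 0) ⟩
    (diag n (λ k d → evenTerm k (suc d)) + evenTerm (suc n) 0) + diag n (λ k d → y * oddTerm k d)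
      ≡⟨ cong₂ _+_ (diag-last n evenTerm) (*-distribˡ-diag n y oddTerm) ⟨
    even (suc n) + y * odd n ∎
    where
    lemma : ∀ p q r → p + q + r ≡ (p + r) + q
    lemma = solve-∀ ℚ-ring
    inner : ∀ k d → oddTerm k (suc d) ≡ evenTerm k (suc d) + y * oddTerm k d
    inner k d = begin
      fromℤ (+ (suc N C suc d)) * (x ^ k * (y * y ^ d))
        ≡⟨ cong (_* (x ^ k * (y * y ^ d))) (pascal N d) ⟩
      (fromℤ (+ (N C d)) + fromℤ (+ (N C suc d))) * (x ^ k * (y * y ^ d))
        ≡⟨ lemma′ (fromℤ (+ (N C d))) (fromℤ (+ (N C suc d))) (x ^ k) y (y ^ d) ⟩
      evenTerm k (suc d) + y * (fromℤ (+ (N C d)) * (x ^ k * y ^ d))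
        ≡⟨ cong (λ i → evenTerm k (suc d) + y * (fromℤ (+ (i C d)) * (x ^ k * y ^ d)))
             (ℕ.+-suc (k ℕ.* 2) d) ⟩
      evenTerm k (suc d) + y * oddTerm k d ∎
      where
      N = k ℕ.* 2 ℕ.+ suc d
      lemma′ : ∀ p q z y t → (p + q) * (z * (y * t)) ≡ q * (z * (y * t)) + y * (p * (z * t))
      lemma′ = solve-∀ ℚ-ring

  lucasTerm : (n : ℕ) .{{_ : ℕ.NonZero n}} → ℕ → ℕ → ℚ
  lucasTerm n k d =
    x ^ k * (+ n / (n ℕ.+ k)) {{m+n-nonZero n k}} * fromℤ (+ ((n ℕ.+ k) C d)) * y ^ d

  -- The sequence V of power sums of the roots of t² - (x + 2y) t + y². Its value at 0 is set
  -- separately, because the formula would call for `even` at -1; the value 2 is the one that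
  -- extends the recurrence down to 0.
  lucas : ℕ → ℚ
  lucas zero    = fromℤ (+ 2)
  lucas (suc n) = even (suc n) + y * even n

  lucas-1 : lucas 1 ≡ x + fromℤ (+ 2) * y
  lucas-1 = lemma x y
    where
    lemma : ∀ x y → 1ℚ * (1ℚ * (y * 1ℚ)) + 1ℚ * (x * 1ℚ * 1ℚ) + y * (1ℚ * (1ℚ * 1ℚ))
      ≡ x + fromℤ (+ 2) * y
    lemma = solve-∀ ℚ-ring

  -- Eliminating `odd` from `even-suc` and `odd-suc` gives this recurrence for `even`, and linearity
  -- passes it on to `lucas`. The first instance involves the separately chosen `lucas 0` and is
  -- checked by expansion.
  lucas-rec : ∀ n → lucas (suc (suc n)) ≡ (x + fromℤ (+ 2) * y) * lucas (suc n) - y * y * lucas n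
  lucas-rec zero = lemma x y
    where
    lemma : ∀ x y →
      1ℚ * (1ℚ * (y * (y * 1ℚ))) + (fromℤ (+ 3) * (x * 1ℚ * (y * 1ℚ)) + 1ℚ * (x * (x * 1ℚ) * 1ℚ))
        + y * (1ℚ * (1ℚ * (y * 1ℚ)) + 1ℚ * (x * 1ℚ * 1ℚ))
      ≡ (x + fromℤ (+ 2) * y)
          * (1ℚ * (1ℚ * (y * 1ℚ)) + 1ℚ * (x * 1ℚ * 1ℚ) + y * (1ℚ * (1ℚ * 1ℚ)))
        - y * y * fromℤ (+ 2)
    lemma = solve-∀ ℚ-ring
  lucas-rec (suc n) = begin
    even (3 ℕ.+ n) + y * even (2 ℕ.+ n)
      ≡⟨ cong₂ (λ p q → p + y * q) (even-rec (suc n)) (even-rec n) ⟩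
    ((x + fromℤ (+ 2) * y) * even (2 ℕ.+ n) - y * y * even (suc n))
      + y * ((x + fromℤ (+ 2) * y) * even (suc n) - y * y * even n)
      ≡⟨ lemma x y (even (2 ℕ.+ n)) (even (suc n)) (even n) ⟩
    (x + fromℤ (+ 2) * y) * lucas (2 ℕ.+ n) - y * y * lucas (suc n) ∎
    where
    lemma : ∀ x y p q r →
      ((x + fromℤ (+ 2) * y) * p - y * y * q) + y * ((x + fromℤ (+ 2) * y) * q - y * y * r)
      ≡ (x + fromℤ (+ 2) * y) * (p + y * q) - y * y * (q + y * r)
    lemma = solve-∀ ℚ-ring
    even-rec : ∀ n → even (2 ℕ.+ n) ≡ (x + fromℤ (+ 2) * y) * even (suc n) - y * y * even n
    even-rec n = begin
      even (2 ℕ.+ n)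
        ≡⟨ even-suc (suc n) ⟩
      x * odd (suc n) + y * even (suc n)
        ≡⟨ cong (λ o → x * o + y * even (suc n)) (odd-suc n) ⟩
      x * (even (suc n) + y * odd n) + y * even (suc n)
        -- `y * even n` is added and subtracted so that `even-suc`, read backwards, absorbs
        -- `x * odd n`.
        ≡⟨ lemma₁ x y (even (suc n)) (odd n) (even n) ⟩
      (x + y) * even (suc n) + y * ((x * odd n + y * even n) - y * even n)
        ≡⟨ cong (λ e → (x + y) * even (suc n) + y * (e - y * even n)) (even-suc n) ⟨
      (x + y) * even (suc n) + y * (even (suc n) - y * even n)
        ≡⟨ lemma₂ x y (even (suc n)) (even n) ⟩
      (x + fromℤ (+ 2) * y) * even (suc n) - y * y * even n ∎
      where
      lemma₁ : ∀ x y p q r → x * (p + y * q) + y * p ≡ (x + y) * p + y * ((x * q + y * r) - y * r)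
      lemma₁ = solve-∀ ℚ-ring
      lemma₂ : ∀ x y p r → (x + y) * p + y * (p - y * r) ≡ (x + fromℤ (+ 2) * y) * p - y * y * r
      lemma₂ = solve-∀ ℚ-ring

  -- After scaling by powers of `D`, both sides satisfy W(n+2) = (a + b) W(n+1) - ab W(n), with
  -- values 2 and a + b at 0 and 1. Scaling keeps the hypotheses free of division.
  lucas-powers : ∀ D a b → D * (x + fromℤ (+ 2) * y) ≡ a + b → D * y * (D * y) ≡ a * b →
    ∀ n → D ^ n * lucas n ≡ a ^ n + b ^ n
  lucas-powers D a b sum-eq prod-eq zero = refl
  lucas-powers D a b sum-eq prod-eq (suc zero) = begin
    D * 1ℚ * lucas 1      ≡⟨ cong (D * 1ℚ *_) lucas-1 ⟩
    D * 1ℚ * (x + fromℤ (+ 2) * y) ≡⟨ cong (_* (x + fromℤ (+ 2) * y)) (ℚ.*-identityʳ D) ⟩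
    D * (x + fromℤ (+ 2) * y) ≡⟨ sum-eq ⟩
    a + b                 ≡⟨ cong₂ _+_ (ℚ.*-identityʳ a) (ℚ.*-identityʳ b) ⟨
    a * 1ℚ + b * 1ℚ       ∎
  lucas-powers D a b sum-eq prod-eq (suc (suc n)) = begin
    D * (D * D ^ n) * lucas (2 ℕ.+ n)
      ≡⟨ cong (D * (D * D ^ n) *_) (lucas-rec n) ⟩
    D * (D * D ^ n) * (s * lucas (suc n) - y * y * lucas n)
      ≡⟨ lemma₁ D (D ^ n) s y (lucas (suc n)) (lucas n) ⟩
    D * s * (D * D ^ n * lucas (suc n)) - D * y * (D * y) * (D ^ n * lucas n)
      ≡⟨ cong₂ _-_ (cong₂ _*_ sum-eq (lucas-powers D a b sum-eq prod-eq (suc n)))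
                   (cong₂ _*_ prod-eq (lucas-powers D a b sum-eq prod-eq n)) ⟩
    (a + b) * (a * a ^ n + b * b ^ n) - a * b * (a ^ n + b ^ n)
      ≡⟨ lemma₂ a b (a ^ n) (b ^ n) ⟩
    a * (a * a ^ n) + b * (b * b ^ n) ∎
    where
    s = x + fromℤ (+ 2) * y
    lemma₁ : ∀ D E s y p q →
      D * (D * E) * (s * p - y * y * q) ≡ D * s * (D * E * p) - D * y * (D * y) * (E * q)
    lemma₁ = solve-∀ ℚ-ring
    lemma₂ : ∀ a b p q →
      (a + b) * (a * p + b * q) - a * b * (p + q) ≡ a * (a * p) + b * (b * q)
    lemma₂ = solve-∀ ℚ-ring

  -- With N = n + k and e = n - k one has 2n = N + e, so N times the doubled weighted coefficient is
  -- N C(N, e) + e C(N, e), and absorption turns the second summand into N C(N-1, e-1). The entry e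
  -- = 0 has no such second summand and is treated apart: its weight is 1/2.
  lucas-sum : ∀ n .{{_ : ℕ.NonZero n}} → fromℤ (+ 2) * diag n (lucasTerm n) ≡ lucas n
  lucas-sum n@(suc m) = begin
    fromℤ (+ 2) * diag n (lucasTerm n)
      ≡⟨ *-distribˡ-diag n (fromℤ (+ 2)) (lucasTerm n) ⟩
    diag n (λ k d → fromℤ (+ 2) * lucasTerm n k d)
      ≡⟨ diag-last m (λ k d → fromℤ (+ 2) * lucasTerm n k d) ⟩
    diag m (λ k d → fromℤ (+ 2) * lucasTerm n k (suc d)) + fromℤ (+ 2) * lucasTerm n n 0
      ≡⟨ cong₂ _+_ (trans (diag-cong m inner) (diag-+ m (λ k d → evenTerm k (suc d)) (λ k d → y * evenTerm k d))) top ⟩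
    diag m (λ k d → evenTerm k (suc d)) + diag m (λ k d → y * evenTerm k d) + evenTerm n 0
      ≡⟨ lemma (diag m (λ k d → evenTerm k (suc d))) (diag m (λ k d → y * evenTerm k d)) (evenTerm n 0) ⟩
    diag m (λ k d → evenTerm k (suc d)) + evenTerm n 0 + diag m (λ k d → y * evenTerm k d)
      ≡⟨ cong₂ _+_ (diag-last m evenTerm) (*-distribˡ-diag m y evenTerm) ⟨
    lucas n ∎
    where
    lemma : ∀ p q r → p + q + r ≡ p + r + q
    lemma = solve-∀ ℚ-ring

    top : fromℤ (+ 2) * lucasTerm n n 0 ≡ evenTerm n 0
    top = begin
      fromℤ (+ 2) * (x ^ n * q * 1ℚ * 1ℚ)
        ≡⟨ lemma₁ q (x ^ n) ⟩
      q * fromℤ (+ 2) * (x ^ n * 1ℚ)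
        ≡⟨ cong (_* (x ^ n * 1ℚ)) q*2≡1 ⟩
      1ℚ * (x ^ n * 1ℚ) ∎
      where
      q = + n / (n ℕ.+ n)
      lemma₁ : ∀ q z → fromℤ (+ 2) * (z * q * 1ℚ * 1ℚ) ≡ q * fromℤ (+ 2) * (z * 1ℚ)
      lemma₁ = solve-∀ ℚ-ring
      lemma₂ : ∀ p q → p * (q * fromℤ (+ 2)) ≡ q * (p + p)
      lemma₂ = solve-∀ ℚ-ring
      -- The quotient n/(n + n) does not reduce for variable n, so its value is found after
      -- multiplying by n.
      scaled : fromℤ (+ n) * (q * fromℤ (+ 2)) ≡ fromℤ (+ n)
      scaled = begin
        fromℤ (+ n) * (q * fromℤ (+ 2))  ≡⟨ lemma₂ (fromℤ (+ n)) q ⟩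
        q * (fromℤ (+ n) + fromℤ (+ n))  ≡⟨ cong (q *_) (fromℤ-+ (+ n) (+ n)) ⟨
        q * fromℤ (+ (n ℕ.+ n))          ≡⟨ /-*-cancel (+ n) (n ℕ.+ n) ⟩
        fromℤ (+ n)                      ∎
      q*2≡1 : q * fromℤ (+ 2) ≡ 1ℚ
      q*2≡1 = begin
        q * fromℤ (+ 2)            ≡⟨ *⇒÷ (q * fromℤ (+ 2)) (fromℤ (+ n)) _ scaled ⟩
        fromℤ (+ n) ÷ fromℤ (+ n)  ≡⟨ ℚ.*-inverseʳ (fromℤ (+ n)) ⟩
        1ℚ                         ∎

    inner : ∀ k d → k ℕ.+ d ≡ m →
      fromℤ (+ 2) * lucasTerm n k (suc d) ≡ evenTerm k (suc d) + y * evenTerm k d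
    -- Matching `refl` turns n into `suc (k + d)`, so that n + k is visibly the successor `N`.
    inner k d refl = begin
      fromℤ (+ 2) * (x ^ k * q * c′ * (y * y ^ d))
        ≡⟨ lemma₁ (x ^ k) q c′ y (y ^ d) ⟩
      fromℤ (+ 2) * q * c′ * (x ^ k * (y * y ^ d))
        ≡⟨ cong (_* (x ^ k * (y * y ^ d))) coeff ⟩
      (c′ + c) * (x ^ k * (y * y ^ d))
        ≡⟨ lemma₂ c′ c (x ^ k) y (y ^ d) ⟩
      c′ * (x ^ k * (y * y ^ d)) + y * (c * (x ^ k * y ^ d))
        ≡⟨ cong₂ (λ i j → fromℤ (+ (i C suc d)) * (x ^ k * (y * y ^ d)) + y * (fromℤ (+ (j C d)) * (x ^ k * y ^ d)))
             (index′ k d) (index k d) ⟩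
      evenTerm k (suc d) + y * evenTerm k d ∎
      where
      N = suc (k ℕ.+ d ℕ.+ k)
      q = + n / N
      c′ = fromℤ (+ (N C suc d))
      c = fromℤ (+ ((k ℕ.+ d ℕ.+ k) C d))
      index′ : ∀ k d → suc (k ℕ.+ d ℕ.+ k) ≡ k ℕ.* 2 ℕ.+ suc d
      index′ = ℕ-Solver.solve-∀
      index : ∀ k d → k ℕ.+ d ℕ.+ k ≡ k ℕ.* 2 ℕ.+ d
      index = ℕ-Solver.solve-∀
      lemma₁ : ∀ z q c y t →
        fromℤ (+ 2) * (z * q * c * (y * t)) ≡ fromℤ (+ 2) * q * c * (z * (y * t))
      lemma₁ = solve-∀ ℚ-ring
      lemma₂ : ∀ c′ c z y t →
        (c′ + c) * (z * (y * t)) ≡ c′ * (z * (y * t)) + y * (c * (z * t))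
      lemma₂ = solve-∀ ℚ-ring
      double : ∀ k d → suc (k ℕ.+ d) ℕ.+ suc (k ℕ.+ d) ≡ suc (k ℕ.+ d ℕ.+ k) ℕ.+ suc d
      double = ℕ-Solver.solve-∀
      lemma₃ : ∀ N q c → N * (fromℤ (+ 2) * q * c) ≡ (q * N + q * N) * c
      lemma₃ = solve-∀ ℚ-ring
      lemma₄ : ∀ N e c → (N + e) * c ≡ N * c + e * c
      lemma₄ = solve-∀ ℚ-ring
      absorb : fromℤ (+ suc d) * c′ ≡ fromℤ (+ N) * c
      absorb = begin
        fromℤ (+ suc d) * c′
          ≡⟨ fromℤ-* (+ suc d) (+ (N C suc d)) ⟨
        fromℤ (+ suc d ℤ.* + (N C suc d))
          ≡⟨ cong fromℤ (ℤ.pos-* (suc d) (N C suc d)) ⟨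
        fromℤ (+ (suc d ℕ.* (N C suc d)))
          ≡⟨ cong (λ i → fromℤ (+ i)) ([k+1]*[n+1]C[k+1]≡[n+1]*nCk (k ℕ.+ d ℕ.+ k) d) ⟩
        fromℤ (+ (N ℕ.* ((k ℕ.+ d ℕ.+ k) C d)))
          ≡⟨ cong fromℤ (ℤ.pos-* N ((k ℕ.+ d ℕ.+ k) C d)) ⟩
        fromℤ (+ N ℤ.* + ((k ℕ.+ d ℕ.+ k) C d))
          ≡⟨ fromℤ-* (+ N) (+ ((k ℕ.+ d ℕ.+ k) C d)) ⟩
        fromℤ (+ N) * c ∎
      scaled : fromℤ (+ N) * (fromℤ (+ 2) * q * c′) ≡ fromℤ (+ N) * (c′ + c)
      scaled = begin
        fromℤ (+ N) * (fromℤ (+ 2) * q * c′)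
          ≡⟨ lemma₃ (fromℤ (+ N)) q c′ ⟩
        (q * fromℤ (+ N) + q * fromℤ (+ N)) * c′
          -- The doubled numerator 2n is about to be split by `double` as N + (d + 1).
          ≡⟨ cong (λ z → (z + z) * c′) (/-*-cancel (+ n) N) ⟩
        (fromℤ (+ n) + fromℤ (+ n)) * c′
          ≡⟨ cong (_* c′) (fromℤ-+ (+ n) (+ n)) ⟨
        fromℤ (+ (n ℕ.+ n)) * c′
          ≡⟨ cong (λ i → fromℤ (+ i) * c′) (double k d) ⟩
        fromℤ (+ (N ℕ.+ suc d)) * c′
          ≡⟨ cong (_* c′) (fromℤ-+ (+ N) (+ suc d)) ⟩
        (fromℤ (+ N) + fromℤ (+ suc d)) * c′
          ≡⟨ lemma₄ (fromℤ (+ N)) (fromℤ (+ suc d)) c′ ⟩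
        fromℤ (+ N) * c′ + fromℤ (+ suc d) * c′
          ≡⟨ cong (_+_ (fromℤ (+ N) * c′)) absorb ⟩
        fromℤ (+ N) * c′ + fromℤ (+ N) * c
          ≡⟨ ℚ.*-distribˡ-+ (fromℤ (+ N)) c′ c ⟨
        fromℤ (+ N) * (c′ + c) ∎
      coeff : fromℤ (+ 2) * q * c′ ≡ c′ + c
      coeff = trans (*⇒÷ _ (fromℤ (+ N)) _ scaled) (sym (*⇒÷ (c′ + c) (fromℤ (+ N)) _ refl))

-- Fibonacci and Lucas identities at natural indices.

-- Both sides obey the Fibonacci recurrence. This expresses Lucas numbers through Fibonacci numbers,
-- so that later identities become polynomial in F(n+1) and F(n); the additive form avoids truncated
-- subtraction.
luc+fib≡2fib : ∀ n → luc n ℕ.+ fib n ≡ 2 ℕ.* fib (suc n)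
luc+fib≡2fib zero          = refl
luc+fib≡2fib (suc zero)    = refl
luc+fib≡2fib (suc (suc n)) = begin
  luc (suc n) ℕ.+ luc n ℕ.+ (fib (suc n) ℕ.+ fib n)
    ≡⟨ lemma (luc (suc n)) (luc n) (fib (suc n)) (fib n) ⟩
  luc (suc n) ℕ.+ fib (suc n) ℕ.+ (luc n ℕ.+ fib n)
    ≡⟨ cong₂ ℕ._+_ (luc+fib≡2fib (suc n)) (luc+fib≡2fib n) ⟩
  2 ℕ.* fib (2 ℕ.+ n) ℕ.+ 2 ℕ.* fib (suc n)
    ≡⟨ ℕ.*-distribˡ-+ 2 (fib (2 ℕ.+ n)) (fib (suc n)) ⟨
  2 ℕ.* fib (3 ℕ.+ n) ∎
  where
  lemma : ∀ a b c d → a ℕ.+ b ℕ.+ (c ℕ.+ d) ≡ a ℕ.+ c ℕ.+ (b ℕ.+ d)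
  lemma = ℕ-Solver.solve-∀

-- The induction moves one unit from `m` to `n`.
fib-+ : ∀ m n → fib (suc (m ℕ.+ n)) ≡ fib (suc m) ℕ.* fib (suc n) ℕ.+ fib m ℕ.* fib n
fib-+ zero    n = lemma (fib (suc n)) (fib n)
  where
  lemma : ∀ a b → a ≡ 1 ℕ.* a ℕ.+ 0 ℕ.* b
  lemma = ℕ-Solver.solve-∀
fib-+ (suc m) n = begin
  fib (suc (suc (m ℕ.+ n)))
    ≡⟨ cong (λ i → fib (suc i)) (ℕ.+-suc m n) ⟨
  fib (suc (m ℕ.+ suc n))
    ≡⟨ fib-+ m (suc n) ⟩
  fib (suc m) ℕ.* (fib (suc n) ℕ.+ fib n) ℕ.+ fib m ℕ.* fib (suc n)
    ≡⟨ lemma (fib (suc m)) (fib m) (fib (suc n)) (fib n) ⟩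
  fib (2 ℕ.+ m) ℕ.* fib (suc n) ℕ.+ fib (suc m) ℕ.* fib n ∎
  where
  lemma : ∀ a b c d → a ℕ.* (c ℕ.+ d) ℕ.+ b ℕ.* c ≡ (a ℕ.+ b) ℕ.* c ℕ.+ a ℕ.* d
  lemma = ℕ-Solver.solve-∀

fib-2* : ∀ n → fib (2 ℕ.* n) ≡ fib n ℕ.* luc n
fib-2* zero    = refl
fib-2* (suc n) = begin
  fib (suc (n ℕ.+ suc (n ℕ.+ 0)))
    ≡⟨ cong (λ i → fib (suc (n ℕ.+ suc i))) (ℕ.+-identityʳ n) ⟩
  fib (suc (n ℕ.+ suc n))
    ≡⟨ fib-+ n (suc n) ⟩
  a ℕ.* (a ℕ.+ b) ℕ.+ b ℕ.* a
    -- Adding `a * a` to both sides makes the sum `luc (suc n) + a` appear, whose value is known.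
    ≡⟨ ℕ.+-cancelʳ-≡ (a ℕ.* a) _ _ eq ⟩
  a ℕ.* luc (suc n) ∎
  where
  a = fib (suc n)
  b = fib n
  lemma : ∀ a b → a ℕ.* (a ℕ.+ b) ℕ.+ b ℕ.* a ℕ.+ a ℕ.* a ≡ a ℕ.* (2 ℕ.* (a ℕ.+ b))
  lemma = ℕ-Solver.solve-∀
  eq : a ℕ.* (a ℕ.+ b) ℕ.+ b ℕ.* a ℕ.+ a ℕ.* a ≡ a ℕ.* luc (suc n) ℕ.+ a ℕ.* a
  eq = begin
    a ℕ.* (a ℕ.+ b) ℕ.+ b ℕ.* a ℕ.+ a ℕ.* a  ≡⟨ lemma a b ⟩
    a ℕ.* (2 ℕ.* (a ℕ.+ b))                  ≡⟨ cong (a ℕ.*_) (luc+fib≡2fib (suc n)) ⟨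
    a ℕ.* (luc (suc n) ℕ.+ a)                ≡⟨ ℕ.*-distribˡ-+ a (luc (suc n)) a ⟩
    a ℕ.* luc (suc n) ℕ.+ a ℕ.* a            ∎

pos-luc : ∀ n → + luc n ≡ + 2 ℤ.* + fib (suc n) ℤ.- + fib n
pos-luc n = begin
  + luc n                                ≡⟨ lemma (+ luc n) (+ fib n) ⟩
  + (luc n ℕ.+ fib n) ℤ.- + fib n        ≡⟨ cong (λ i → + i ℤ.- + fib n) (luc+fib≡2fib n) ⟩
  + (2 ℕ.* fib (suc n)) ℤ.- + fib n      ≡⟨ cong (ℤ._- + fib n) (ℤ.pos-* 2 (fib (suc n))) ⟩
  + 2 ℤ.* + fib (suc n) ℤ.- + fib n      ∎
  where
  lemma : ∀ a b → a ≡ a ℤ.+ b ℤ.- b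
  lemma = ℤ-Solver.solve-∀

-- The quantity `c` is (-1)ⁿ: passing to the next index negates it. Squaring removes the sign, which
-- is all that is used later.
cassini : ∀ n → let a = + fib (suc n); b = + fib n; c = a ℤ.* a ℤ.- a ℤ.* b ℤ.- b ℤ.* b in
  c ℤ.* c ≡ + 1
cassini zero    = refl
cassini (suc n) = trans (lemma (+ fib (suc n)) (+ fib n)) (cassini n)
  where
  lemma : ∀ a b →
    let s = a ℤ.+ b; c = s ℤ.* s ℤ.- s ℤ.* a ℤ.- a ℤ.* a
        c′ = a ℤ.* a ℤ.- a ℤ.* b ℤ.- b ℤ.* b in
    c ℤ.* c ≡ c′ ℤ.* c′
  lemma = ℤ-Solver.solve-∀

-- Substituting L = 2F(n+1) - F(n) makes L² - 5F² four times the Cassini expression.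
luc²-5fib² : ∀ n → let c = + luc n ℤ.* + luc n ℤ.- + 5 ℤ.* (+ fib n ℤ.* + fib n) in
  c ℤ.* c ≡ + 16
luc²-5fib² n = begin
  sq (+ luc n)
    ≡⟨ cong sq (pos-luc n) ⟩
  sq (+ 2 ℤ.* + fib (suc n) ℤ.- + fib n)
    ≡⟨ lemma (+ fib (suc n)) (+ fib n) ⟩
  + 16 ℤ.* (c ℤ.* c)
    ≡⟨ cong (+ 16 ℤ.*_) (cassini n) ⟩
  + 16 ∎
  where
  a = + fib (suc n)
  b = + fib n
  c = a ℤ.* a ℤ.- a ℤ.* b ℤ.- b ℤ.* b
  sq : ℤ → ℤ
  sq l = (l ℤ.* l ℤ.- + 5 ℤ.* (b ℤ.* b)) ℤ.* (l ℤ.* l ℤ.- + 5 ℤ.* (b ℤ.* b))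
  lemma : ∀ a b → let l = + 2 ℤ.* a ℤ.- b; e = l ℤ.* l ℤ.- + 5 ℤ.* (b ℤ.* b)
                      c = a ℤ.* a ℤ.- a ℤ.* b ℤ.- b ℤ.* b in
    e ℤ.* e ≡ + 16 ℤ.* (c ℤ.* c)
  lemma = ℤ-Solver.solve-∀

-- Everything is rewritten in `a` and `b`: L(2n) = 2F(2n+1) - F(2n), with F(2n+1) = a² + b² by the
-- addition formula and F(2n) = b L(n). A polynomial identity remains.
luc-2* : ∀ n → + 2 ℤ.* + luc (2 ℕ.* n) ≡ + luc n ℤ.* + luc n ℤ.+ + 5 ℤ.* (+ fib n ℤ.* + fib n)
luc-2* n = begin
  + 2 ℤ.* + luc (2 ℕ.* n)
    ≡⟨ cong (+ 2 ℤ.*_) (pos-luc (2 ℕ.* n)) ⟩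
  + 2 ℤ.* (+ 2 ℤ.* + fib (suc (2 ℕ.* n)) ℤ.- + fib (2 ℕ.* n))
    ≡⟨ cong₂ (λ i j → + 2 ℤ.* (+ 2 ℤ.* i ℤ.- j)) odd-eq even-eq ⟩
  + 2 ℤ.* (+ 2 ℤ.* (a ℤ.* a ℤ.+ b ℤ.* b) ℤ.- b ℤ.* + luc n)
    ≡⟨ cong (λ l → + 2 ℤ.* (+ 2 ℤ.* (a ℤ.* a ℤ.+ b ℤ.* b) ℤ.- b ℤ.* l)) (pos-luc n) ⟩
  + 2 ℤ.* (+ 2 ℤ.* (a ℤ.* a ℤ.+ b ℤ.* b) ℤ.- b ℤ.* (+ 2 ℤ.* a ℤ.- b))
    ≡⟨ lemma a b ⟩
  (+ 2 ℤ.* a ℤ.- b) ℤ.* (+ 2 ℤ.* a ℤ.- b) ℤ.+ + 5 ℤ.* (b ℤ.* b)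
    ≡⟨ cong (λ l → l ℤ.* l ℤ.+ + 5 ℤ.* (b ℤ.* b)) (pos-luc n) ⟨
  + luc n ℤ.* + luc n ℤ.+ + 5 ℤ.* (b ℤ.* b) ∎
  where
  a = + fib (suc n)
  b = + fib n
  odd-eq : + fib (suc (2 ℕ.* n)) ≡ a ℤ.* a ℤ.+ b ℤ.* b
  odd-eq = begin
    + fib (suc (n ℕ.+ (n ℕ.+ 0)))
      ≡⟨ cong (λ i → + fib (suc (n ℕ.+ i))) (ℕ.+-identityʳ n) ⟩
    + fib (suc (n ℕ.+ n))
      ≡⟨ cong +_ (fib-+ n n) ⟩
    + (fib (suc n) ℕ.* fib (suc n)) ℤ.+ + (fib n ℕ.* fib n)
      ≡⟨ cong₂ ℤ._+_ (ℤ.pos-* (fib (suc n)) (fib (suc n))) (ℤ.pos-* (fib n) (fib n)) ⟩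
    a ℤ.* a ℤ.+ b ℤ.* b ∎
  even-eq : + fib (2 ℕ.* n) ≡ b ℤ.* + luc n
  even-eq = trans (cong +_ (fib-2* n)) (ℤ.pos-* (fib n) (luc n))
  lemma : ∀ a b → let l = + 2 ℤ.* a ℤ.- b in
    + 2 ℤ.* (+ 2 ℤ.* (a ℤ.* a ℤ.+ b ℤ.* b) ℤ.- b ℤ.* l) ≡ l ℤ.* l ℤ.+ + 5 ℤ.* (b ℤ.* b)
  lemma = ℤ-Solver.solve-∀

-- Extension to negative indices.

-1^-square : ∀ m → -1ℤ ℤ.^ m ℤ.* -1ℤ ℤ.^ m ≡ + 1
-1^-square zero    = refl
-1^-square (suc m) = trans (lemma (-1ℤ ℤ.^ m)) (-1^-square m)
  where
  lemma : ∀ s → (-1ℤ ℤ.* s) ℤ.* (-1ℤ ℤ.* s) ≡ s ℤ.* s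
  lemma = ℤ-Solver.solve-∀

-- The exponent is 2m + 1 in the shape to which `+ 2 ℤ.* -[1+ m ]` computes inside `F` and `L`.
-1^-odd : ∀ m → -1ℤ ℤ.^ (m ℕ.+ suc (m ℕ.+ 0)) ≡ -1ℤ
-1^-odd m = begin
  -1ℤ ℤ.^ (m ℕ.+ suc (m ℕ.+ 0))       ≡⟨ cong (λ i → -1ℤ ℤ.^ (m ℕ.+ suc i)) (ℕ.+-identityʳ m) ⟩
  -1ℤ ℤ.^ (m ℕ.+ suc m)               ≡⟨ ℤ.^-distribˡ-+-* -1ℤ m (suc m) ⟩
  -1ℤ ℤ.^ m ℤ.* (-1ℤ ℤ.* -1ℤ ℤ.^ m)   ≡⟨ lemma (-1ℤ ℤ.^ m) ⟩
  -1ℤ ℤ.* (-1ℤ ℤ.^ m ℤ.* -1ℤ ℤ.^ m)   ≡⟨ cong (-1ℤ ℤ.*_) (-1^-square m) ⟩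
  -1ℤ                                 ∎
  where
  lemma : ∀ s → s ℤ.* (-1ℤ ℤ.* s) ≡ -1ℤ ℤ.* (s ℤ.* s)
  lemma = ℤ-Solver.solve-∀

signed-square : ∀ s i → s ℤ.* s ≡ + 1 → (s ℤ.* i) ℤ.* (s ℤ.* i) ≡ i ℤ.* i
signed-square s i s²≡1 = begin
  (s ℤ.* i) ℤ.* (s ℤ.* i)  ≡⟨ lemma s i ⟩
  (s ℤ.* s) ℤ.* (i ℤ.* i)  ≡⟨ cong (ℤ._* (i ℤ.* i)) s²≡1 ⟩
  + 1 ℤ.* (i ℤ.* i)        ≡⟨ ℤ.*-identityˡ (i ℤ.* i) ⟩
  i ℤ.* i                  ∎
  where
  lemma : ∀ s i → (s ℤ.* i) ℤ.* (s ℤ.* i) ≡ (s ℤ.* s) ℤ.* (i ℤ.* i)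
  lemma = ℤ-Solver.solve-∀

F²≡fib² : ∀ m → F -[1+ m ] ℤ.* F -[1+ m ] ≡ + fib (suc m) ℤ.* + fib (suc m)
F²≡fib² m = signed-square (-1ℤ ℤ.^ m) (+ fib (suc m)) (-1^-square m)

L²≡luc² : ∀ m → L -[1+ m ] ℤ.* L -[1+ m ] ≡ + luc (suc m) ℤ.* + luc (suc m)
L²≡luc² m = signed-square (-1ℤ ℤ.^ suc m) (+ luc (suc m)) (-1^-square (suc m))

F-2* : ∀ p → F (+ 2 ℤ.* p) ≡ F p ℤ.* L p
F-2* (+ n) = begin
  F (+ 2 ℤ.* + n)       ≡⟨ cong F (ℤ.pos-* 2 n) ⟨
  + fib (2 ℕ.* n)       ≡⟨ cong +_ (fib-2* n) ⟩
  + (fib n ℕ.* luc n)   ≡⟨ ℤ.pos-* (fib n) (luc n) ⟩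
  + fib n ℤ.* + luc n   ∎
F-2* -[1+ m ] = begin
  -1ℤ ℤ.^ (m ℕ.+ suc (m ℕ.+ 0)) ℤ.* + fib (2 ℕ.* suc m)
    ≡⟨ cong₂ ℤ._*_ (-1^-odd m) (trans (cong +_ (fib-2* (suc m))) (ℤ.pos-* (fib (suc m)) (luc (suc m)))) ⟩
  -1ℤ ℤ.* (+ fib (suc m) ℤ.* + luc (suc m))
    -- A factor s² = 1 with s = (-1)ᵐ is inserted: s is the sign of `F`, and -s that of `L`.
    ≡⟨ cong (λ i → i ℤ.* (+ fib (suc m) ℤ.* + luc (suc m))) (cong (-1ℤ ℤ.*_) (-1^-square m)) ⟨
  -1ℤ ℤ.* (-1ℤ ℤ.^ m ℤ.* -1ℤ ℤ.^ m) ℤ.* (+ fib (suc m) ℤ.* + luc (suc m))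
    ≡⟨ lemma (-1ℤ ℤ.^ m) (+ fib (suc m)) (+ luc (suc m)) ⟩
  F -[1+ m ] ℤ.* L -[1+ m ] ∎
  where
  lemma : ∀ s f l → -1ℤ ℤ.* (s ℤ.* s) ℤ.* (f ℤ.* l) ≡ (s ℤ.* f) ℤ.* ((-1ℤ ℤ.* s) ℤ.* l)
  lemma = ℤ-Solver.solve-∀

-- At a negative index the left sign is +1, since the index is even, and the squares on the right
-- lose their signs; the natural case remains.
L-2* : ∀ p → + 2 ℤ.* L (+ 2 ℤ.* p) ≡ L p ℤ.* L p ℤ.+ + 5 ℤ.* (F p ℤ.* F p)
L-2* (+ n) = trans (cong (λ i → + 2 ℤ.* L i) (sym (ℤ.pos-* 2 n))) (luc-2* n)
L-2* -[1+ m ] = begin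
  + 2 ℤ.* (-1ℤ ℤ.* -1ℤ ℤ.^ (m ℕ.+ suc (m ℕ.+ 0)) ℤ.* + luc (2 ℕ.* suc m))
    ≡⟨ cong (λ s → + 2 ℤ.* (-1ℤ ℤ.* s ℤ.* + luc (2 ℕ.* suc m))) (-1^-odd m) ⟩
  + 2 ℤ.* (+ 1 ℤ.* + luc (2 ℕ.* suc m))
    ≡⟨ cong (+ 2 ℤ.*_) (ℤ.*-identityˡ (+ luc (2 ℕ.* suc m))) ⟩
  + 2 ℤ.* + luc (2 ℕ.* suc m)
    ≡⟨ luc-2* (suc m) ⟩
  + luc (suc m) ℤ.* + luc (suc m) ℤ.+ + 5 ℤ.* (+ fib (suc m) ℤ.* + fib (suc m))
    ≡⟨ cong₂ (λ i j → i ℤ.+ + 5 ℤ.* j) (L²≡luc² m) (F²≡fib² m) ⟨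
  L -[1+ m ] ℤ.* L -[1+ m ] ℤ.+ + 5 ℤ.* (F -[1+ m ] ℤ.* F -[1+ m ]) ∎

L²-5F² : ∀ p → let c = L p ℤ.* L p ℤ.- + 5 ℤ.* (F p ℤ.* F p) in c ℤ.* c ≡ + 16
L²-5F² (+ n)    = luc²-5fib² n
L²-5F² -[1+ m ] = trans
  (cong₂ (λ i j → (i ℤ.- + 5 ℤ.* j) ℤ.* (i ℤ.- + 5 ℤ.* j)) (L²≡luc² m) (F²≡fib² m))
  (luc²-5fib² (suc m))

-- Completing the square: 25f⁴ + l⁴ = (l² - 5f²)² + 10(fl)². The left side is the sum a + b of the
-- two powers' bases.
25F⁴+L⁴ : ∀ p → let f = F p; l = L p; f₂ = F (+ 2 ℤ.* p) in
  + 25 ℤ.* (f ℤ.* f ℤ.* (f ℤ.* f)) ℤ.+ l ℤ.* l ℤ.* (l ℤ.* l) ≡ + 16 ℤ.+ + 10 ℤ.* (f₂ ℤ.* f₂)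
25F⁴+L⁴ p = begin
  + 25 ℤ.* (f ℤ.* f ℤ.* (f ℤ.* f)) ℤ.+ l ℤ.* l ℤ.* (l ℤ.* l)
    ≡⟨ lemma f l ⟩
  c ℤ.* c ℤ.+ + 10 ℤ.* (f ℤ.* l ℤ.* (f ℤ.* l))
    ≡⟨ cong₂ (λ i j → i ℤ.+ + 10 ℤ.* (j ℤ.* j)) (L²-5F² p) (sym (F-2* p)) ⟩
  + 16 ℤ.+ + 10 ℤ.* (F (+ 2 ℤ.* p) ℤ.* F (+ 2 ℤ.* p)) ∎
  where
  f = F p
  l = L p
  c = l ℤ.* l ℤ.- + 5 ℤ.* (f ℤ.* f)
  lemma : ∀ f l → let c = l ℤ.* l ℤ.- + 5 ℤ.* (f ℤ.* f) in
    + 25 ℤ.* (f ℤ.* f ℤ.* (f ℤ.* f)) ℤ.+ l ℤ.* l ℤ.* (l ℤ.* l)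
    ≡ c ℤ.* c ℤ.+ + 10 ℤ.* (f ℤ.* l ℤ.* (f ℤ.* l))
  lemma = ℤ-Solver.solve-∀

-- Squaring `L-2*` gives 4L₂² = (l² + 5f²)² = (l² - 5f²)² + 20(fl)²; the factor 4 is then cancelled.
L₂²≡5F₂²+4 : ∀ p → let f₂ = F (+ 2 ℤ.* p); l₂ = L (+ 2 ℤ.* p) in
  l₂ ℤ.* l₂ ≡ + 5 ℤ.* (f₂ ℤ.* f₂) ℤ.+ + 4
L₂²≡5F₂²+4 p = ℤ.*-cancelˡ-≡ (+ 4) _ _ (begin
  + 4 ℤ.* (l₂ ℤ.* l₂)
    ≡⟨ lemma₁ l₂ ⟩
  (+ 2 ℤ.* l₂) ℤ.* (+ 2 ℤ.* l₂)
    ≡⟨ cong (λ i → i ℤ.* i) (L-2* p) ⟩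
  (l ℤ.* l ℤ.+ + 5 ℤ.* (f ℤ.* f)) ℤ.* (l ℤ.* l ℤ.+ + 5 ℤ.* (f ℤ.* f))
    ≡⟨ lemma₂ f l ⟩
  c ℤ.* c ℤ.+ + 20 ℤ.* (f ℤ.* l ℤ.* (f ℤ.* l))
    ≡⟨ cong₂ (λ i j → i ℤ.+ + 20 ℤ.* (j ℤ.* j)) (L²-5F² p) (sym (F-2* p)) ⟩
  + 16 ℤ.+ + 20 ℤ.* (f₂ ℤ.* f₂)
    ≡⟨ lemma₃ f₂ ⟩
  + 4 ℤ.* (+ 5 ℤ.* (f₂ ℤ.* f₂) ℤ.+ + 4) ∎)
  where
  f = F p
  l = L p
  f₂ = F (+ 2 ℤ.* p)
  l₂ = L (+ 2 ℤ.* p)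
  c = l ℤ.* l ℤ.- + 5 ℤ.* (f ℤ.* f)
  lemma₁ : ∀ l → + 4 ℤ.* (l ℤ.* l) ≡ (+ 2 ℤ.* l) ℤ.* (+ 2 ℤ.* l)
  lemma₁ = ℤ-Solver.solve-∀
  lemma₂ : ∀ f l → let c = l ℤ.* l ℤ.- + 5 ℤ.* (f ℤ.* f); s = l ℤ.* l ℤ.+ + 5 ℤ.* (f ℤ.* f) in
    s ℤ.* s ≡ c ℤ.* c ℤ.+ + 20 ℤ.* (f ℤ.* l ℤ.* (f ℤ.* l))
  lemma₂ = ℤ-Solver.solve-∀
  lemma₃ : ∀ f → + 16 ℤ.+ + 20 ℤ.* (f ℤ.* f) ≡ + 4 ℤ.* (+ 5 ℤ.* (f ℤ.* f) ℤ.+ + 4)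
  lemma₃ = ℤ-Solver.solve-∀

-- The identities carried over to the rationals.

fromℤ-square : ∀ i → fromℤ (i ℤ.* i) ≡ fromℤ i ^ 2
fromℤ-square i = trans (fromℤ-* i i) (cong (fromℤ i *_) (sym (ℚ.*-identityʳ (fromℤ i))))

fromℤ-⁴ : ∀ i → fromℤ (i ℤ.* i ℤ.* (i ℤ.* i)) ≡ fromℤ i ^ 4
fromℤ-⁴ i = trans (fromℤ-* (i ℤ.* i) (i ℤ.* i))
  (trans (cong₂ _*_ (fromℤ-* i i) (fromℤ-* i i)) (lemma (fromℤ i)))
  where
  lemma : ∀ x → x * x * (x * x) ≡ x * (x * (x * (x * 1ℚ)))
  lemma = solve-∀ ℚ-ring

25F⁴+L⁴-ℚ : ∀ p → fromℤ (+ 25) * fromℤ (F p) ^ 4 + fromℤ (L p) ^ 4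
  ≡ fromℤ (+ 16) + fromℤ (+ 10) * fromℤ (F (+ 2 ℤ.* p)) ^ 2
25F⁴+L⁴-ℚ p = begin
  fromℤ (+ 25) * fromℤ f ^ 4 + fromℤ l ^ 4
    ≡⟨ cong₂ (λ i j → fromℤ (+ 25) * i + j) (fromℤ-⁴ f) (fromℤ-⁴ l) ⟨
  fromℤ (+ 25) * fromℤ f⁴ + fromℤ l⁴
    ≡⟨ cong (_+ fromℤ l⁴) (fromℤ-* (+ 25) f⁴) ⟨
  fromℤ (+ 25 ℤ.* f⁴) + fromℤ l⁴
    ≡⟨ fromℤ-+ (+ 25 ℤ.* f⁴) l⁴ ⟨
  fromℤ (+ 25 ℤ.* f⁴ ℤ.+ l⁴)
    ≡⟨ cong fromℤ (25F⁴+L⁴ p) ⟩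
  fromℤ (+ 16 ℤ.+ + 10 ℤ.* (f₂ ℤ.* f₂))
    ≡⟨ fromℤ-+ (+ 16) (+ 10 ℤ.* (f₂ ℤ.* f₂)) ⟩
  fromℤ (+ 16) + fromℤ (+ 10 ℤ.* (f₂ ℤ.* f₂))
    ≡⟨ cong (_+_ (fromℤ (+ 16))) (fromℤ-* (+ 10) (f₂ ℤ.* f₂)) ⟩
  fromℤ (+ 16) + fromℤ (+ 10) * fromℤ (f₂ ℤ.* f₂)
    ≡⟨ cong (λ i → fromℤ (+ 16) + fromℤ (+ 10) * i) (fromℤ-square f₂) ⟩
  fromℤ (+ 16) + fromℤ (+ 10) * fromℤ f₂ ^ 2 ∎
  where
  f = F p
  l = L p
  f⁴ = f ℤ.* f ℤ.* (f ℤ.* f)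
  l⁴ = l ℤ.* l ℤ.* (l ℤ.* l)
  f₂ = F (+ 2 ℤ.* p)

L₂²≡5F₂²+4-ℚ : ∀ p → fromℤ (L (+ 2 ℤ.* p)) ^ 2 ≡ fromℤ (+ 5) * fromℤ (F (+ 2 ℤ.* p)) ^ 2 + fromℤ (+ 4)
L₂²≡5F₂²+4-ℚ p = begin
  fromℤ l₂ ^ 2
    ≡⟨ fromℤ-square l₂ ⟨
  fromℤ (l₂ ℤ.* l₂)
    ≡⟨ cong fromℤ (L₂²≡5F₂²+4 p) ⟩
  fromℤ (+ 5 ℤ.* (f₂ ℤ.* f₂) ℤ.+ + 4)
    ≡⟨ fromℤ-+ (+ 5 ℤ.* (f₂ ℤ.* f₂)) (+ 4) ⟩
  fromℤ (+ 5 ℤ.* (f₂ ℤ.* f₂)) + fromℤ (+ 4)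
    ≡⟨ cong (_+ fromℤ (+ 4)) (fromℤ-* (+ 5) (f₂ ℤ.* f₂)) ⟩
  fromℤ (+ 5) * fromℤ (f₂ ℤ.* f₂) + fromℤ (+ 4)
    ≡⟨ cong (λ i → fromℤ (+ 5) * i + fromℤ (+ 4)) (fromℤ-square f₂) ⟩
  fromℤ (+ 5) * fromℤ f₂ ^ 2 + fromℤ (+ 4) ∎
  where
  f₂ = F (+ 2 ℤ.* p)
  l₂ = L (+ 2 ℤ.* p)

F₂⁴≡F⁴L⁴-ℚ : ∀ p → fromℤ (F (+ 2 ℤ.* p)) ^ 4 ≡ fromℤ (F p) ^ 4 * fromℤ (L p) ^ 4
F₂⁴≡F⁴L⁴-ℚ p = trans
  (cong (_^ 4) (trans (cong fromℤ (F-2* p)) (fromℤ-* (F p) (L p))))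
  (^-distrib-* (fromℤ (F p)) (fromℤ (L p)) 4)

-- Evaluation of the four sums.

-- `E` and `N` are separate arguments because the required denominator and numerator may equal 2Dⁿ
-- and aⁿ + bⁿ only up to a proof.
∑-lucas : ∀ n .{{_ : ℕ.NonZero n}} x y (D a b E N : ℚ) .{{_ : ℚ.NonZero E}} →
  D * (x + fromℤ (+ 2) * y) ≡ a + b → D * y * (D * y) ≡ a * b →
  fromℤ (+ 2) * D ^ n ≡ E → a ^ n + b ^ n ≡ N →
  diag n (lucasTerm x y n) ≡ N ÷ E
∑-lucas n x y D a b E N sum-eq prod-eq E-eq N-eq = *⇒÷ S E N (begin
  E * S                        ≡⟨ cong (_* S) E-eq ⟨
  fromℤ (+ 2) * D ^ n * S      ≡⟨ lemma (fromℤ (+ 2)) (D ^ n) S ⟩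
  D ^ n * (fromℤ (+ 2) * S)    ≡⟨ cong (D ^ n *_) (lucas-sum x y n) ⟩
  D ^ n * lucas x y n          ≡⟨ lucas-powers x y D a b sum-eq prod-eq n ⟩
  a ^ n + b ^ n                ≡⟨ N-eq ⟩
  N                            ∎)
  where
  S = diag n (lucasTerm x y n)
  lemma : ∀ p q r → p * q * r ≡ q * (p * r)
  lemma = solve-∀ ℚ-ring

1^n≡1 : ∀ n → 1ℚ ^ n ≡ 1ℚ
1^n≡1 zero    = refl
1^n≡1 (suc n) = trans (ℚ.*-identityˡ (1ℚ ^ n)) (1^n≡1 n)

numerator-eq : ∀ f l n →
  (fromℤ (+ 25) * f ^ 4) ^ n + (l ^ 4) ^ n ≡ fromℤ (+ 25) ^ n * f ^ (4 ℕ.* n) + l ^ (4 ℕ.* n)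
numerator-eq f l n = cong₂ _+_
  (trans (^-distrib-* (fromℤ (+ 25)) (f ^ 4) n) (cong (fromℤ (+ 25) ^ n *_) (^-assocʳ f 4 n)))
  (^-assocʳ l 4 n)

-- The alternating sign is absorbed into the second variable, y = -z.
alternating-lucasTerm : ∀ x z n .{{_ : ℕ.NonZero n}} k d →
  (- 1ℚ) ^ d * x ^ k * (+ n / (n ℕ.+ k)) {{m+n-nonZero n k}} * fromℤ (+ ((n ℕ.+ k) C d)) * z ^ d
  ≡ lucasTerm x (- 1ℚ * z) n k d
alternating-lucasTerm x z n k d = begin
  (- 1ℚ) ^ d * x ^ k * q * c * z ^ d
    ≡⟨ lemma ((- 1ℚ) ^ d) (x ^ k) q c (z ^ d) ⟩
  x ^ k * q * c * ((- 1ℚ) ^ d * z ^ d)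
    ≡⟨ cong (x ^ k * q * c *_) (^-distrib-* (- 1ℚ) z d) ⟨
  lucasTerm x (- 1ℚ * z) n k d ∎
  where
  q = (+ n / (n ℕ.+ k)) {{m+n-nonZero n k}}
  c = fromℤ (+ ((n ℕ.+ k) C d))
  lemma : ∀ s z q c t → s * z * q * c * t ≡ z * q * c * (s * t)
  lemma = solve-∀ ℚ-ring

module _ (p : ℤ) (n : ℕ) .{{_ : ℕ.NonZero n}} where

  private
    f l f₂ l₂ num : ℚ
    f = fromℤ (F p)
    l = fromℤ (L p)
    f₂ = fromℤ (F (+ 2 ℤ.* p))
    l₂ = fromℤ (L (+ 2 ℤ.* p))
    num = fromℤ (+ 25) ^ n * f ^ (4 ℕ.* n) + l ^ (4 ℕ.* n)

    25f₂⁴ : fromℤ (+ 25) * f₂ ^ 4 ≡ fromℤ (+ 25) * f ^ 4 * l ^ 4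
    25f₂⁴ = trans (cong (fromℤ (+ 25) *_) (F₂⁴≡F⁴L⁴-ℚ p))
      (sym (ℚ.*-assoc (fromℤ (+ 25)) (f ^ 4) (l ^ 4)))

  diag-F₂ : diag n (lucasTerm (+ 16 / 5) (f₂ ^ 2) n)
    ≡ (num ÷ (fromℤ (+ 2) * fromℤ (+ 5) ^ n)) {{2*5^n-nonZero n}}
  diag-F₂ = ∑-lucas n (+ 16 / 5) (f₂ ^ 2) (fromℤ (+ 5)) (fromℤ (+ 25) * f ^ 4) (l ^ 4)
    (fromℤ (+ 2) * fromℤ (+ 5) ^ n) num {{2*5^n-nonZero n}}
    (trans (sum-lemma f₂) (sym (25F⁴+L⁴-ℚ p)))
    (trans (prod-lemma f₂) 25f₂⁴)
    refl (numerator-eq f l n)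
    where
    sum-lemma : ∀ z → fromℤ (+ 5) * (+ 16 / 5 + fromℤ (+ 2) * (z * (z * 1ℚ)))
      ≡ fromℤ (+ 16) + fromℤ (+ 10) * (z * (z * 1ℚ))
    sum-lemma = solve-∀ ℚ-ring
    prod-lemma : ∀ z → fromℤ (+ 5) * (z * (z * 1ℚ)) * (fromℤ (+ 5) * (z * (z * 1ℚ)))
      ≡ fromℤ (+ 25) * (z * (z * (z * (z * 1ℚ))))
    prod-lemma = solve-∀ ℚ-ring

  private
    ratio : ℚ
    ratio = (f₂ ÷ l₂) {{fromℤ-L-nonZero (+ 2 ℤ.* p)}}

    ratio*l₂ : ratio * l₂ ≡ f₂
    ratio*l₂ = ÷-*-cancel f₂ l₂ {{fromℤ-L-nonZero (+ 2 ℤ.* p)}}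

  diag-F₂/L₂ : diag n (lucasTerm (+ 4 / 5) (- 1ℚ * ratio ^ 2) n)
    ≡ (num ÷ (fromℤ (+ 2) * fromℤ (+ 5) ^ n * l₂ ^ (2 ℕ.* n)))
        {{2*5^n*L^m-nonZero n (+ 2 ℤ.* p) (2 ℕ.* n)}}
  diag-F₂/L₂ = ∑-lucas n (+ 4 / 5) (- 1ℚ * ratio ^ 2)
    (fromℤ (+ 5) * l₂ ^ 2) (fromℤ (+ 25) * f ^ 4) (l ^ 4)
    (fromℤ (+ 2) * fromℤ (+ 5) ^ n * l₂ ^ (2 ℕ.* n)) num
    {{2*5^n*L^m-nonZero n (+ 2 ℤ.* p) (2 ℕ.* n)}}
    sum-eq prod-eq denominator-eq (numerator-eq f l n)
    where
    sum-lemma₁ : ∀ r m →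
      fromℤ (+ 5) * (m * (m * 1ℚ)) * (+ 4 / 5 + fromℤ (+ 2) * (- 1ℚ * (r * (r * 1ℚ))))
      ≡ fromℤ (+ 4) * (m * (m * 1ℚ)) - fromℤ (+ 10) * ((r * m) * ((r * m) * 1ℚ))
    sum-lemma₁ = solve-∀ ℚ-ring
    sum-lemma₂ : ∀ z → fromℤ (+ 4) * (fromℤ (+ 5) * z + fromℤ (+ 4)) - fromℤ (+ 10) * z
      ≡ fromℤ (+ 16) + fromℤ (+ 10) * z
    sum-lemma₂ = solve-∀ ℚ-ring
    sum-eq : fromℤ (+ 5) * l₂ ^ 2 * (+ 4 / 5 + fromℤ (+ 2) * (- 1ℚ * ratio ^ 2))
      ≡ fromℤ (+ 25) * f ^ 4 + l ^ 4
    sum-eq = begin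
      fromℤ (+ 5) * l₂ ^ 2 * (+ 4 / 5 + fromℤ (+ 2) * (- 1ℚ * ratio ^ 2))
        -- The factor L₂² in D clears the denominator of the ratio, leaving 4L₂² - 10F₂², which is
        -- 16 + 10F₂² once L₂² is replaced by 5F₂² + 4.
        ≡⟨ sum-lemma₁ ratio l₂ ⟩
      fromℤ (+ 4) * l₂ ^ 2 - fromℤ (+ 10) * (ratio * l₂) ^ 2
        ≡⟨ cong₂ (λ i j → fromℤ (+ 4) * i - fromℤ (+ 10) * j ^ 2) (L₂²≡5F₂²+4-ℚ p) ratio*l₂ ⟩
      fromℤ (+ 4) * (fromℤ (+ 5) * f₂ ^ 2 + fromℤ (+ 4)) - fromℤ (+ 10) * f₂ ^ 2
        ≡⟨ sum-lemma₂ (f₂ ^ 2) ⟩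
      fromℤ (+ 16) + fromℤ (+ 10) * f₂ ^ 2
        ≡⟨ 25F⁴+L⁴-ℚ p ⟨
      fromℤ (+ 25) * f ^ 4 + l ^ 4 ∎
    prod-lemma : ∀ r m →
      fromℤ (+ 5) * (m * (m * 1ℚ)) * (- 1ℚ * (r * (r * 1ℚ)))
        * (fromℤ (+ 5) * (m * (m * 1ℚ)) * (- 1ℚ * (r * (r * 1ℚ))))
      ≡ fromℤ (+ 25) * ((r * m) * ((r * m) * ((r * m) * ((r * m) * 1ℚ))))
    prod-lemma = solve-∀ ℚ-ring
    prod-eq : fromℤ (+ 5) * l₂ ^ 2 * (- 1ℚ * ratio ^ 2)
        * (fromℤ (+ 5) * l₂ ^ 2 * (- 1ℚ * ratio ^ 2))
      ≡ fromℤ (+ 25) * f ^ 4 * l ^ 4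
    prod-eq = begin
      fromℤ (+ 5) * l₂ ^ 2 * (- 1ℚ * ratio ^ 2) * (fromℤ (+ 5) * l₂ ^ 2 * (- 1ℚ * ratio ^ 2))
        ≡⟨ prod-lemma ratio l₂ ⟩
      fromℤ (+ 25) * (ratio * l₂) ^ 4
        ≡⟨ cong (λ z → fromℤ (+ 25) * z ^ 4) ratio*l₂ ⟩
      fromℤ (+ 25) * f₂ ^ 4
        ≡⟨ 25f₂⁴ ⟩
      fromℤ (+ 25) * f ^ 4 * l ^ 4 ∎
    denominator-eq : fromℤ (+ 2) * (fromℤ (+ 5) * l₂ ^ 2) ^ n
      ≡ fromℤ (+ 2) * fromℤ (+ 5) ^ n * l₂ ^ (2 ℕ.* n)
    denominator-eq = begin
      fromℤ (+ 2) * (fromℤ (+ 5) * l₂ ^ 2) ^ n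
        ≡⟨ cong (fromℤ (+ 2) *_) (^-distrib-* (fromℤ (+ 5)) (l₂ ^ 2) n) ⟩
      fromℤ (+ 2) * (fromℤ (+ 5) ^ n * (l₂ ^ 2) ^ n)
        ≡⟨ cong (λ z → fromℤ (+ 2) * (fromℤ (+ 5) ^ n * z)) (^-assocʳ l₂ 2 n) ⟩
      fromℤ (+ 2) * (fromℤ (+ 5) ^ n * l₂ ^ (2 ℕ.* n))
        ≡⟨ ℚ.*-assoc (fromℤ (+ 2)) (fromℤ (+ 5) ^ n) (l₂ ^ (2 ℕ.* n)) ⟨
      fromℤ (+ 2) * fromℤ (+ 5) ^ n * l₂ ^ (2 ℕ.* n) ∎

-- Covers both special sums: 16/5 + 2 and 36/5 - 2 equal 26/5 = (25 + 1)/5, with y = 1 and y = -1.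
-- They are the case p = 1, the second one after multiplication by L₂²ⁿ = 9ⁿ.
diag-26/5 : ∀ n .{{_ : ℕ.NonZero n}} x y → fromℤ (+ 5) * (x + fromℤ (+ 2) * y) ≡ fromℤ (+ 26) →
  fromℤ (+ 5) * y * (fromℤ (+ 5) * y) ≡ fromℤ (+ 25) →
  diag n (lucasTerm x y n)
  ≡ ((fromℤ (+ 25) ^ n + 1ℚ) ÷ (fromℤ (+ 2) * fromℤ (+ 5) ^ n)) {{2*5^n-nonZero n}}
diag-26/5 n x y sum-eq prod-eq = ∑-lucas n x y (fromℤ (+ 5)) (fromℤ (+ 25)) 1ℚ
  (fromℤ (+ 2) * fromℤ (+ 5) ^ n) (fromℤ (+ 25) ^ n + 1ℚ) {{2*5^n-nonZero n}}
  sum-eq prod-eq refl (cong (_+_ (fromℤ (+ 25) ^ n)) (1^n≡1 n))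

theorem5 : (∀ (p : ℤ) .{{_ : ℤ.NonZero p}} (n : ℕ) .{{_ : ℕ.NonZero n}} →
    (∑[ k ≤ n ] ((+ 16 / 5) ^ k * (+ n / (n ℕ.+ k)) {{m+n-nonZero n k}} * fromℤ (+ ((n ℕ.+ k) C (n ∸ k)))
    * fromℤ (F (+ 2 ℤ.* p)) ^ (2 ℕ.* (n ∸ k)))
    ≡ ((fromℤ (+ 25) ^ n * fromℤ (F p) ^ (4 ℕ.* n) + fromℤ (L p) ^ (4 ℕ.* n))
    ÷ (fromℤ (+ 2) * fromℤ (+ 5) ^ n)) {{2*5^n-nonZero n}})
    ×
    (∑[ k ≤ n ] ((- 1ℚ) ^ (n ∸ k) * (+ 4 / 5) ^ k * (+ n / (n ℕ.+ k)) {{m+n-nonZero n k}} * fromℤ (+ ((n ℕ.+ k) C (n ∸ k)))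
    * ((fromℤ (F (+ 2 ℤ.* p)) ÷ fromℤ (L (+ 2 ℤ.* p))) {{fromℤ-L-nonZero (+ 2 ℤ.* p)}}) ^ (2 ℕ.* (n ∸ k)))
    ≡ ((fromℤ (+ 25) ^ n * fromℤ (F p) ^ (4 ℕ.* n) + fromℤ (L p) ^ (4 ℕ.* n))
    ÷ (fromℤ (+ 2) * fromℤ (+ 5) ^ n * fromℤ (L (+ 2 ℤ.* p)) ^ (2 ℕ.* n)))
    {{2*5^n*L^m-nonZero n (+ 2 ℤ.* p) (2 ℕ.* n)}}))
    × (∀ (n : ℕ) .{{_ : ℕ.NonZero n}} →
    (∑[ k ≤ n ] ((+ 16 / 5) ^ k * (+ n / (n ℕ.+ k)) {{m+n-nonZero n k}} * fromℤ (+ ((n ℕ.+ k) C (n ∸ k))))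
    ≡ ((fromℤ (+ 25) ^ n + 1ℚ) ÷ (fromℤ (+ 2) * fromℤ (+ 5) ^ n)) {{2*5^n-nonZero n}})
    ×
    (∑[ k ≤ n ] ((- 1ℚ) ^ (n ∸ k) * (+ 36 / 5) ^ k * (+ n / (n ℕ.+ k)) {{m+n-nonZero n k}} * fromℤ (+ ((n ℕ.+ k) C (n ∸ k))))
    ≡ ((fromℤ (+ 25) ^ n + 1ℚ) ÷ (fromℤ (+ 2) * fromℤ (+ 5) ^ n)) {{2*5^n-nonZero n}}))
theorem5 =
  (λ p n →
    let f₂ = fromℤ (F (+ 2 ℤ.* p))
        r = (f₂ ÷ fromℤ (L (+ 2 ℤ.* p))) {{fromℤ-L-nonZero (+ 2 ℤ.* p)}}
        q = λ k → (+ n / (n ℕ.+ k)) {{m+n-nonZero n k}}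
        c = λ k d → fromℤ (+ ((n ℕ.+ k) C d))
    in
    -- Once n - k has become the free index d, the power with exponent 2d is regrouped as the d-th
    -- power of a square, which plays the part of y (up to sign in the second sum).
    trans (∑≤≡diag n λ k d → (+ 16 / 5) ^ k * q k * c k d * f₂ ^ (2 ℕ.* d)) (trans
      (diag-cong n λ k d _ → cong ((+ 16 / 5) ^ k * q k * c k d *_) (sym (^-assocʳ f₂ 2 d)))
      (diag-F₂ p n)) ,
    trans (∑≤≡diag n λ k d → (- 1ℚ) ^ d * (+ 4 / 5) ^ k * q k * c k d * r ^ (2 ℕ.* d)) (trans
      (diag-cong n λ k d _ → trans
        (cong ((- 1ℚ) ^ d * (+ 4 / 5) ^ k * q k * c k d *_) (sym (^-assocʳ r 2 d)))
        (alternating-lucasTerm (+ 4 / 5) (r ^ 2) n k d))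
      (diag-F₂/L₂ p n))) ,
  (λ n →
    let q = λ k → (+ n / (n ℕ.+ k)) {{m+n-nonZero n k}}
        c = λ k d → fromℤ (+ ((n ℕ.+ k) C d))
        -- The special sums show no power of y; a factor 1ᵈ is supplied to match `lucasTerm`.
        *1^ = λ s d → sym (trans (cong (s *_) (1^n≡1 d)) (ℚ.*-identityʳ s))
    in
    trans (∑≤≡diag n λ k d → (+ 16 / 5) ^ k * q k * c k d) (trans
      (diag-cong n λ k d _ → *1^ ((+ 16 / 5) ^ k * q k * c k d) d)
      (diag-26/5 n (+ 16 / 5) 1ℚ refl refl)) ,
    trans (∑≤≡diag n λ k d → (- 1ℚ) ^ d * (+ 36 / 5) ^ k * q k * c k d) (trans
      (diag-cong n λ k d _ → trans
        (*1^ ((- 1ℚ) ^ d * (+ 36 / 5) ^ k * q k * c k d) d)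
        (alternating-lucasTerm (+ 36 / 5) 1ℚ n k d))
      (diag-26/5 n (+ 36 / 5) (- 1ℚ * 1ℚ) refl refl)))
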